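{- Let $D=(V,A)$ be a weak cycle on $n$ vertices, with vertices labeled in order around the cycle as $v_0,v_1,\dots,v_{n-1}$ (indices modulo $n$). Let $$V_-=\{i: (v_{i+1},v_i)\in A\text{ and }(v_i,v_{i+1})\notin A\},$$ $$V_+=\{j: (v_j,v_{j+1})\in A\text{ and }(v_{j+1},v_j)\notin A\},$$ $$V_0=\{k: (v_k,v_{k+1})\in A\text{ and }(v_{k+1},v_k)\in A\},$$ and suppose that $V_0$, $V_-$ and $V_+$ are all nonempty. Let $d(i,j)=j-i \bmod n\in\{0,1,\dots,n-1\}$ and set $\ell=\min\{d(i,j): i\in V_-,\ j\in V_+\}$. Then $$F(D)=n-1-\left\lfloor\frac{\ell}{2}\right\rfloor.$$
   Context: A finite simple digraph $D=(V,A)$ has finite nonempty vertex set $V$ and arc set $A$ consisting of ordered pairs of distinct vertices (no loops, no parallel arcs; both $(u,v)$ and $(v,u)$ may be present). $N_D^+(v)=\{u:(v,u)\in A\}$. A weak cycle is a digraph whose underlying undirected graph (replace each arc $(u,v)$ by the edge $\{u,v\}$) is a cycle; thus cyclically consecutive vertices $v_i,v_{i+1}$ are joined by one or both of the arcs $(v_i,v_{i+1}),(v_{i+1},v_i)$, and there are no other arcs. Zero forcing: for $S\subseteq V$ let $B^0(S)=S$ and $B^{i+1}(S)=B^i(S)\cup\{w:\{w\}=N_D^+(v)\setminus B^i(S)\text{ for some }v\in B^i(S)\}$. $S$ is a zero forcing set (ZFS) if $B^t(S)=V$ for some $t\ge 0$, and a failed zero forcing set (FZFS) otherwise. The failed zero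 forcing number $F(D)$ is the largest cardinality of an FZFS of $D$. -}

module Defs where

open import Data.Bool.Properties using () renaming (_≟_ to _≟ᵇ_)
open import Data.Fin using (Fin; toℕ)
open import Data.Fin.Permutation using (Permutation′; _⟨$⟩ʳ_)
open import Data.Fin.Properties using (any?)
open import Data.Fin.Subset using (Subset; _∈_; _∪_; _─_; ⁅_⁆; ⊤; ∣_∣)
open import Data.Fin.Subset.Properties using (_∈?_)
open import Data.Nat using (ℕ; zero; suc; _+_; _∸_; _≤_; NonZero)
open import Data.Nat.DivMod using (_%_; _mod_)
open import Data.Product using (_×_; ∃; ∃₂)
open import Data.Sum using (_⊎_)
open import Data.Vec using (tabulate)
open import Data.Vec.Properties using (≡-dec)
open import Function.Bundles using (_⇔_)
open import Level using (0ℓ)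
open import Relation.Binary.Core using (Rel)
open import Relation.Binary.Definitions using (Decidable)
open import Relation.Binary.PropositionalEquality using (_≡_)
open import Relation.Nullary using (¬_; Dec; does)
open import Relation.Nullary.Decidable using (_×-dec_)
open import Relation.Unary using (Pred)

IsLargest : Pred ℕ 0ℓ → Pred ℕ 0ℓ
IsLargest P m = P m × (∀ k → P k → k ≤ m)

IsSmallest : Pred ℕ 0ℓ → Pred ℕ 0ℓ
IsSmallest P m = P m × (∀ k → P k → m ≤ k)

-- The vertex set is Fin n.  Decidability of Arc makes the arcs a finite set of
-- ordered pairs.
record Digraph (n : ℕ) .{{_ : NonZero n}} : Set₁ where
  field
    Arc      : Rel (Fin n) 0ℓ
    Arc?     : Decidable Arc
    loopless : ∀ v → ¬ Arc v v

  N⁺ : Fin n → Subset n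
  N⁺ v = tabulate (λ u → does (Arc? v u))

  Adjacent : Rel (Fin n) 0ℓ
  Adjacent u w = Arc u w ⊎ Arc w u

module _ {n : ℕ} .{{_ : NonZero n}} (D : Digraph n) where
  open Digraph D

  Forced : Subset n → Pred (Fin n) 0ℓ
  Forced B w = ∃ λ v → v ∈ B × ⁅ w ⁆ ≡ N⁺ v ─ B

  forced? : ∀ B w → Dec (Forced B w)
  forced? B w = any? (λ v → (v ∈? B) ×-dec ≡-dec _≟ᵇ_ ⁅ w ⁆ (N⁺ v ─ B))

  B^ : ℕ → Subset n → Subset n
  B^ zero    S = S
  B^ (suc i) S = B^ i S ∪ tabulate (λ w → does (forced? (B^ i S) w))

  IsZFS : Pred (Subset n) 0ℓ
  IsZFS S = ∃ λ t → B^ t S ≡ ⊤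

  IsFZFS : Pred (Subset n) 0ℓ
  IsFZFS S = ¬ IsZFS S

  -- IsF k says F(D) = k.
  IsF : Pred ℕ 0ℓ
  IsF = IsLargest (λ k → ∃ λ S → IsFZFS S × ∣ S ∣ ≡ k)

module _ {n : ℕ} .{{_ : NonZero n}} where

  next : Fin n → Fin n
  next i = suc (toℕ i) mod n

  -- j - i mod n; n is added first so that the truncated subtraction is exact.
  d : Fin n → Fin n → ℕ
  d i j = (n + toℕ j ∸ toℕ i) % n

-- D is a weak cycle whose vertices, in order around the cycle, are
-- v ⟨$⟩ʳ 0, …, v ⟨$⟩ʳ (n - 1).  The underlying graph is simple, so a cycle has
-- at least 3 vertices.
record IsWeakCycle {n : ℕ} .{{_ : NonZero n}}
                   (D : Digraph n) (v : Permutation′ n) : Set where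
  open Digraph D
  field
    3≤n      : 3 ≤ n
    adjacent : ∀ i j → Adjacent (v ⟨$⟩ʳ i) (v ⟨$⟩ʳ j) ⇔ (j ≡ next i ⊎ i ≡ next j)

module _ {n : ℕ} .{{_ : NonZero n}} (D : Digraph n) (v : Permutation′ n) where
  open Digraph D

  V₋ V₊ V₀ : Pred (Fin n) 0ℓ
  V₋ i = Arc (v ⟨$⟩ʳ next i) (v ⟨$⟩ʳ i) × ¬ Arc (v ⟨$⟩ʳ i) (v ⟨$⟩ʳ next i)
  V₊ j = Arc (v ⟨$⟩ʳ j) (v ⟨$⟩ʳ next j) × ¬ Arc (v ⟨$⟩ʳ next j) (v ⟨$⟩ʳ j)
  V₀ k = Arc (v ⟨$⟩ʳ k) (v ⟨$⟩ʳ next k) × Arc (v ⟨$⟩ʳ next k) (v ⟨$⟩ʳ k)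

  -- Isℓ m says min { d(i,j) : i ∈ V₋, j ∈ V₊ } = m.
  Isℓ : Pred ℕ 0ℓ
  Isℓ = IsSmallest (λ m → ∃₂ λ i j → V₋ i × V₊ j × d i j ≡ m)

{-# OPTIONS --safe #-}
module Submission where

-- Let W be the complement of a failed set closed under forcing.  Reading around the cycle, a
-- pattern 0 0 1 (1 marking W) forces the edge before the 1 to be in V₋, since otherwise the middle
-- vertex would force; symmetrically a pattern 1 0 0 forces the edge after the 1 to be in V₊.
-- If W never misses two consecutive vertices then 2|W| ≥ n > ℓ.  Otherwise go from two missed
-- vertices to the next 0 0 1 and from there to the next 1 0 0: the stretch between them, of
-- length L ≥ ℓ, starts and ends in W and has no two consecutive gaps, so 2|W| ≥ L + 1.
-- Conversely, between closest edges of V₋ and V₊ every edge is in V₀, and the set W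
-- occupying every other vertex there, and the last one, cannot be forced into.

open import Defs
open import Data.Bool using (Bool; true; false; if_then_else_)
open import Data.Bool.Properties using (¬-not; _≟_)
open import Data.Fin using (Fin; toℕ)
open import Data.Fin.Permutation using (Permutation′; _⟨$⟩ʳ_; _⟨$⟩ˡ_; inverseˡ; inverseʳ)
open import Data.Fin.Properties using (any?; toℕ-injective; toℕ-fromℕ<; toℕ<n; ¬∀⟶∃¬)
open import Data.Fin.Subset using (Subset; inside; outside; _∈_; _∉_; _⊆_; _─_; ⁅_⁆; ⊤; ∣_∣; ∁)
open import Data.Fin.Subset.Properties
open import Data.Nat using (ℕ; zero; suc; _+_; _*_; _∸_; _≤_; _<_; z≤n; s≤s; ⌊_/2⌋; ⌈_/2⌉; _≡ᵇ_;
  NonZero; >-nonZero⁻¹)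
open import Data.Nat.DivMod
open import Data.Nat.Properties hiding (_≟_)
open import Data.Nat.Solver using (module +-*-Solver)
open import Data.Product using (_×_; _,_; ∃; proj₁; proj₂)
open import Data.Sum using (_⊎_; inj₁; inj₂; [_,_]′)
open import Data.Vec using (lookup; tabulate; []; _∷_; here; there)
open import Data.Vec.Properties using (lookup∘tabulate; lookup⇒[]=; []=⇒lookup)
open import Function using (_∘_; id)
open import Function.Bundles using (module Equivalence)
open import Level using (0ℓ)
open import Relation.Binary.PropositionalEquality
open import Relation.Nullary using (¬_; Dec; yes; no; does; contradiction)
open import Relation.Nullary.Decidable using (dec-true; _×-dec_)
open import Relation.Unary using (Pred; Decidable; Satisfiable)
open import Algebra.Properties.CommutativeMonoid.Sum +-0-commutativeMonoid
  using (sum; sum-permute; sum-cong-≗)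

private
  variable
    n : ℕ

-- Counting true entries in Boolean sequences.

bit : Bool → ℕ
bit b = if b then 1 else 0

count : (ℕ → Bool) → ℕ → ℕ
count f zero    = 0
count f (suc k) = bit (f 0) + count (f ∘ suc) k

count-cong : ∀ {f g} k → (∀ m → m < k → f m ≡ g m) → count f k ≡ count g k
count-cong zero    f≗g = refl
count-cong (suc k) f≗g =
  cong₂ _+_ (cong bit (f≗g 0 (s≤s z≤n))) (count-cong k (λ m m<k → f≗g (suc m) (s≤s m<k)))

count-suc : ∀ f k → count f (suc k) ≡ count f k + bit (f k)
count-suc f zero    = +-comm (bit (f 0)) 0
count-suc f (suc k) =
  trans (cong (bit (f 0) +_) (count-suc (f ∘ suc) k)) (sym (+-assoc (bit (f 0)) _ _))

count-mono : ∀ f {j k} → j ≤ k → count f j ≤ count f k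
count-mono f z≤n       = z≤n
count-mono f (s≤s j≤k) = +-monoʳ-≤ (bit (f 0)) (count-mono (f ∘ suc) j≤k)

-- Sliding the window by one step drops `f p` and picks up `f (n + p)`, which agree by periodicity.
count-periodic : ∀ (f : ℕ → Bool) n → (∀ m → f (n + m) ≡ f m) →
                 ∀ p → count (λ m → f (m + p)) n ≡ count f n
count-periodic f n per zero    = count-cong n (λ m _ → cong f (+-identityʳ m))
count-periodic f n per (suc p) = trans (+-cancelˡ-≡ (bit (f p)) _ _ eq) (count-periodic f n per p)
  where
  g : ℕ → Bool
  g m = f (m + p)
  open ≡-Reasoning
  eq : bit (f p) + count (λ m → f (m + suc p)) n ≡ bit (f p) + count g n
  eq = begin
    bit (f p) + count (λ m → f (m + suc p)) n
      ≡⟨ cong (bit (f p) +_) (count-cong n (λ m _ → cong f (+-suc m p))) ⟩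
    count g (suc n)             ≡⟨ count-suc g n ⟩
    count g n + bit (g n)       ≡⟨ cong (λ b → count g n + bit b) (per p) ⟩
    count g n + bit (f p)       ≡⟨ +-comm (count g n) _ ⟩
    bit (f p) + count g n       ∎

-- A true entry pays for two positions, itself and a neighbouring gap. Doubling the count keeps the
-- bookkeeping free of rounding.
count-gain : ∀ f {j} k → f 0 ≡ true → j ≤ 2 * count (f ∘ suc) k → 2 + j ≤ 2 * count f (suc k)
count-gain f {j} k f0 j≤ = subst (λ b → 2 + j ≤ 2 * (bit b + c)) (sym f0)
  (subst (2 + j ≤_) (cong suc (sym (+-suc c (c + 0)))) (s≤s (s≤s j≤)))
  where
  c = count (f ∘ suc) k

count-skip : ∀ f {j} k → j ≤ 2 * count (f ∘ suc) k → j ≤ 2 * count f (suc k)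
count-skip f k j≤ = ≤-trans j≤ (*-monoʳ-≤ 2 (m≤n+m _ (bit (f 0))))

true-or-false : ∀ b → b ≡ true ⊎ b ≡ false
true-or-false true  = inj₁ refl
true-or-false false = inj₂ refl

-- Every false entry comes right after a true one, which pays for both.
count-dense : ∀ (f : ℕ → Bool) → f 0 ≡ true → (∀ m → f m ≡ false → f (suc m) ≡ true) →
              ∀ k → k ≤ 2 * count f k
count-dense f f0 dense zero = z≤n
count-dense f f0 dense (suc zero) = ≤-trans (s≤s z≤n) (count-gain f 0 f0 z≤n)
count-dense f f0 dense (suc (suc k)) =
  [ (λ f1 → ≤-trans (n≤1+n _)
      (count-gain f (suc k) f0 (count-dense (f ∘ suc) f1 (dense ∘ suc) (suc k))))
  -- With `f 1` false, density makes `f 2` true, so the recursion restarts two places on.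
  , (λ f1 → count-gain f (suc k) f0
      (count-skip (f ∘ suc) k (count-dense (f ∘ suc ∘ suc) (dense 1 f1) (dense ∘ suc ∘ suc) k)))
  ]′ (true-or-false (f 1))

first-rise : ∀ (f : ℕ → Bool) m → f 0 ≡ false → f 1 ≡ false → f (suc m) ≡ true →
             ∃ λ k → suc k ≤ m × f k ≡ false × f (1 + k) ≡ false × f (2 + k) ≡ true
first-rise f zero    f0 f1 fm = contradiction (trans (sym f1) fm) λ ()
first-rise f (suc m) f0 f1 fm with true-or-false (f 2)
... | inj₁ f2 = 0 , s≤s z≤n , f0 , f1 , f2
... | inj₂ f2 with first-rise (f ∘ suc) m f1 f2 fm
...   | k , k≤ , h = suc k , s≤s k≤ , h

-- Before the first 1 0 0 no two false entries are adjacent. The `suc k` entries read so far begin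
-- and end with a true one, so true entries outnumber false ones; this gives one more than
-- `count-dense`.
first-drop : ∀ (f : ℕ → Bool) m → f 0 ≡ true → f m ≡ false → f (suc m) ≡ false →
             ∃ λ k → suc k ≤ m × f k ≡ true × f (1 + k) ≡ false × f (2 + k) ≡ false
                     × 2 + k ≤ 2 * count f (suc k)
first-drop f zero    f0 fm fm′ = contradiction (trans (sym f0) fm) λ ()
first-drop f (suc m) f0 fm fm′ with true-or-false (f 1)
first-drop f (suc m) f0 fm fm′ | inj₁ f1 with first-drop (f ∘ suc) m f1 fm fm′
... | k , k≤ , fk , fk′ , fk″ , c =
  suc k , s≤s k≤ , fk , fk′ , fk″ , ≤-trans (n≤1+n _) (count-gain f (suc k) f0 c)
first-drop f (suc m) f0 fm fm′ | inj₂ f1 with true-or-false (f 2)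
first-drop f (suc m) f0 fm fm′ | inj₂ f1 | inj₂ f2 =
  0 , s≤s z≤n , f0 , f1 , f2 , count-gain f 0 f0 z≤n
first-drop f (suc zero) f0 fm fm′ | inj₂ f1 | inj₁ f2 =
  contradiction (trans (sym f2) fm′) λ ()
first-drop f (suc (suc m)) f0 fm fm′ | inj₂ f1 | inj₁ f2
  with first-drop (f ∘ suc ∘ suc) m f2 fm fm′
... | k , k≤ , fk , fk′ , fk″ , c =
  2 + k , s≤s (s≤s k≤) , fk , fk′ , fk″ ,
  count-gain f (2 + k) f0 (count-skip (f ∘ suc) (suc k) c)

-- The alternating pattern of the extremal set.

-- 1010…1 for odd length, 1010…11 for even positive length.
pattern-bit : ℕ → ℕ → Bool
pattern-bit zero          k             = false
pattern-bit (suc zero)    zero          = true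
pattern-bit (suc zero)    (suc k)       = false
pattern-bit (suc (suc ℓ)) zero          = true
pattern-bit (suc (suc ℓ)) (suc zero)    = ℓ ≡ᵇ 0
pattern-bit (suc (suc ℓ)) (suc (suc k)) = pattern-bit ℓ k

pattern-support : ∀ ℓ k → pattern-bit ℓ k ≡ true → k < ℓ
pattern-support (suc zero)       zero          _ = s≤s z≤n
pattern-support (suc (suc ℓ))    zero          _ = s≤s z≤n
pattern-support (suc (suc ℓ))    (suc zero)    _ = s≤s (s≤s z≤n)
pattern-support (suc (suc ℓ))    (suc (suc k)) h = s≤s (s≤s (pattern-support ℓ k h))

pattern-first : ∀ ℓ → 0 < ℓ → pattern-bit ℓ 0 ≡ true
pattern-first (suc zero)    _ = refl
pattern-first (suc (suc ℓ)) _ = refl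

pattern-last : ∀ ℓ → pattern-bit (suc ℓ) ℓ ≡ true
pattern-last zero          = refl
pattern-last (suc zero)    = refl
pattern-last (suc (suc ℓ)) = pattern-last ℓ

pattern-dense : ∀ ℓ k → suc k < ℓ → pattern-bit ℓ k ≡ false → pattern-bit ℓ (suc k) ≡ true
pattern-dense (suc zero) (suc k) (s≤s ()) _
pattern-dense (suc (suc zero)) (suc k) (s≤s (s≤s ())) _
pattern-dense (suc (suc (suc ℓ))) (suc zero) _ _ = pattern-first (suc ℓ) (s≤s z≤n)
pattern-dense (suc (suc (suc ℓ))) (suc (suc k)) (s≤s (s≤s p)) h = pattern-dense (suc ℓ) k p h

count-false : ∀ k → count (λ _ → false) k ≡ 0
count-false zero    = refl
count-false (suc k) = count-false k

-- This is the fewest true entries possible with both ends true and no two adjacent gaps, so the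
-- bound in `first-drop` is attained up to parity.
count-pattern : ∀ ℓ n → suc ℓ ≤ n → count (pattern-bit (suc ℓ)) n ≡ suc ⌊ suc ℓ /2⌋
count-pattern zero (suc n) _ = cong suc (count-false n)
count-pattern (suc zero) (suc zero) (s≤s ())
count-pattern (suc zero) (suc (suc n)) _ = cong (suc ∘ suc) (count-false n)
count-pattern (suc (suc ℓ)) (suc (suc n)) (s≤s (s≤s p)) = cong suc (count-pattern ℓ n p)

-- Membership and size of subsets.

∈-tabulate⁺ : ∀ {P : Pred (Fin n) 0ℓ} (P? : Decidable P) {x} → P x → x ∈ tabulate (does ∘ P?)
∈-tabulate⁺ P? {x} px =
  lookup⇒[]= x _ (trans (lookup∘tabulate _ x) (dec-true (P? x) px))

∈-tabulate⁻ : ∀ {P : Pred (Fin n) 0ℓ} (P? : Decidable P) {x} → x ∈ tabulate (does ∘ P?) → P x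
∈-tabulate⁻ P? {x} x∈ with P? x | trans (sym (lookup∘tabulate (does ∘ P?) x)) ([]=⇒lookup x∈)
... | yes px | _ = px

x∈p─q⇒x∉q : ∀ (p q : Subset n) {x} → x ∈ p ─ q → x ∉ q
x∈p─q⇒x∉q (inside  ∷ _) (inside ∷ _) () here
x∈p─q⇒x∉q (outside ∷ _) (inside ∷ _) () here
x∈p─q⇒x∉q (_ ∷ p) (_ ∷ q)      (there x∈p─q) (there x∈q) = x∈p─q⇒x∉q p q x∈p─q x∈q

lookup-∈ : ∀ {p : Subset n} {x} → lookup p x ≡ true → x ∈ p
lookup-∈ {p = p} {x} = lookup⇒[]= x p

lookup-∉ : ∀ {p : Subset n} {x} → lookup p x ≡ false → x ∉ p
lookup-∉ eq x∈p = contradiction (trans (sym eq) ([]=⇒lookup x∈p)) λ ()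

∉-lookup : ∀ {p : Subset n} {x} → x ∉ p → lookup p x ≡ false
∉-lookup x∉p = ¬-not (x∉p ∘ lookup-∈)

missing : ∀ (p : Subset n) → p ≢ ⊤ → ∃ λ x → x ∉ p
missing p p≢⊤ = ¬∀⟶∃¬ _ (_∈ p) (_∈? p) (λ all → p≢⊤ (⊆-antisym (λ _ → ∈⊤) (λ {x} _ → all x)))

∣p∣≡sum : ∀ (p : Subset n) → ∣ p ∣ ≡ sum (bit ∘ lookup p)
∣p∣≡sum []            = refl
∣p∣≡sum (inside  ∷ p) = cong suc (∣p∣≡sum p)
∣p∣≡sum (outside ∷ p) = ∣p∣≡sum p

sum≡count : ∀ n f → sum {n} (λ i → bit (f (toℕ i))) ≡ count f n
sum≡count zero    f = refl
sum≡count (suc n) f = cong (bit (f 0) +_) (sum≡count n (f ∘ suc))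

-- Arithmetic modulo n and cyclic distance.

module _ {n : ℕ} .{{_ : NonZero n}} where

  toℕ-mod : ∀ m → toℕ (m mod n) ≡ m % n
  toℕ-mod m = toℕ-fromℕ< (m%n<n m n)

  mod-cong : ∀ {k m} → k % n ≡ m % n → k mod n ≡ m mod n
  mod-cong {k} {m} eq = toℕ-injective (trans (toℕ-mod k) (trans eq (sym (toℕ-mod m))))

  mod-toℕ : ∀ (i : Fin n) → toℕ i mod n ≡ i
  mod-toℕ i = toℕ-injective (trans (toℕ-mod (toℕ i)) (m<n⇒m%n≡m (toℕ<n i)))

  %-+ʳ : ∀ k m → (k + m % n) % n ≡ (k + m) % n
  %-+ʳ k m = trans (%-distribˡ-+ k (m % n) n)
    (trans (cong (λ x → (k % n + x) % n) (m%n%n≡m%n m n)) (sym (%-distribˡ-+ k m n)))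

  -- Adding `n ∸ 1` undoes a successor modulo `n`.
  %-suc-injective : ∀ j k → suc j % n ≡ suc k % n → j % n ≡ k % n
  %-suc-injective j k eq = trans (unwind j)
    (trans (cong (λ r → (n ∸ 1 + r) % n) eq) (sym (unwind k)))
    where
    open ≡-Reasoning
    unwind : ∀ m → m % n ≡ (n ∸ 1 + suc m % n) % n
    unwind m = begin
      m % n                      ≡⟨ [m+n]%n≡m%n m n ⟨
      (m + n) % n                ≡⟨ cong (_% n) (trans (+-comm m n) (cong (_+ m) (sym (m+[n∸m]≡n (>-nonZero⁻¹ n))))) ⟩
      (suc (n ∸ 1) + m) % n      ≡⟨ cong (_% n) (+-suc (n ∸ 1) m) ⟨
      (n ∸ 1 + suc m) % n        ≡⟨ %-+ʳ (n ∸ 1) (suc m) ⟨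
      (n ∸ 1 + suc m % n) % n    ∎

  next-mod : ∀ m → next (m mod n) ≡ suc m mod n
  next-mod m = mod-cong (trans (cong (λ x → suc x % n) (toℕ-mod m)) (%-+ʳ 1 m))

  d<n : ∀ (i j : Fin n) → d i j < n
  d<n i j = m%n<n (n + toℕ j ∸ toℕ i) n

  mod-d : ∀ (i j : Fin n) → (d i j + toℕ i) mod n ≡ j
  mod-d i j = trans (mod-cong eq) (mod-toℕ j)
    where
    open ≡-Reasoning
    a = toℕ i
    b = toℕ j
    eq : (d i j + a) % n ≡ b % n
    eq = begin
      ((n + b ∸ a) % n + a) % n  ≡⟨ cong (_% n) (+-comm _ a) ⟩
      (a + (n + b ∸ a) % n) % n  ≡⟨ %-+ʳ a (n + b ∸ a) ⟩
      (a + (n + b ∸ a)) % n      ≡⟨ cong (_% n) (m+[n∸m]≡n (≤-trans (<⇒≤ (toℕ<n i)) (m≤m+n n b))) ⟩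
      (n + b) % n                ≡⟨ cong (_% n) (+-comm n b) ⟩
      (b + n) % n                ≡⟨ [m+n]%n≡m%n b n ⟩
      b % n                      ∎

  d-mod : ∀ a k → k < n → d (a mod n) ((k + a) mod n) ≡ k
  d-mod a k k<n = trans eq (by-cases (r + k <? n))
    where
    open ≡-Reasoning
    r = a % n
    eq : d (a mod n) ((k + a) mod n) ≡ (n + (r + k) % n ∸ r) % n
    eq = cong₂ (λ x y → (n + x ∸ y) % n)
      (trans (toℕ-mod (k + a)) (trans (sym (%-+ʳ k a)) (cong (_% n) (+-comm k r)))) (toℕ-mod a)
    -- The cases are whether `k` steps from the residue `r` pass the origin; if they do, the `n`
    -- added in `d` restores the one lost in the reduction.
    by-cases : Dec (r + k < n) → (n + (r + k) % n ∸ r) % n ≡ k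
    by-cases (yes r+k<n) = begin
      (n + (r + k) % n ∸ r) % n  ≡⟨ cong (λ x → (n + x ∸ r) % n) (m<n⇒m%n≡m r+k<n) ⟩
      (n + (r + k) ∸ r) % n      ≡⟨ cong (λ x → (x ∸ r) % n) (solve 3 (λ n r k → n :+ (r :+ k) := r :+ (k :+ n)) refl n r k) ⟩
      (r + (k + n) ∸ r) % n      ≡⟨ cong (_% n) (m+n∸m≡n r (k + n)) ⟩
      (k + n) % n                ≡⟨ [m+n]%n≡m%n k n ⟩
      k % n                      ≡⟨ m<n⇒m%n≡m k<n ⟩
      k                          ∎
      where open +-*-Solver
    by-cases (no r+k≮n) = begin
      (n + (r + k) % n ∸ r) % n  ≡⟨ cong (λ x → (n + x ∸ r) % n) (trans (sym (m≤n⇒[n∸m]%m≡n%m n≤)) (m<n⇒m%n≡m s<n)) ⟩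
      (n + (r + k ∸ n) ∸ r) % n  ≡⟨ cong (λ x → (x ∸ r) % n) (m+[n∸m]≡n n≤) ⟩
      (r + k ∸ r) % n            ≡⟨ cong (_% n) (m+n∸m≡n r k) ⟩
      k % n                      ≡⟨ m<n⇒m%n≡m k<n ⟩
      k                          ∎
      where
      n≤ : n ≤ r + k
      n≤ = ≮⇒≥ r+k≮n
      s<n : r + k ∸ n < n
      s<n = +-cancelʳ-< n _ _ (subst (_< n + n) (sym (m∸n+n≡m n≤)) (+-mono-< (m%n<n a n) k<n))

-- Forcing and stalled sets.

module _ {n : ℕ} .{{_ : NonZero n}} (D : Digraph n) where
  open Digraph D

  -- Pointwise form of `⁅ w ⁆ ≡ N⁺ u ─ B`, with the forcing vertex exposed.
  Forces : Subset n → Fin n → Fin n → Set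
  Forces B u w = u ∈ B × w ∉ B × Arc u w × (∀ y → Arc u y → y ∉ B → y ≡ w)

  Forced⁻ : ∀ {B w} → Forced D B w → ∃ λ u → Forces B u w
  Forced⁻ {B} {w} (u , u∈B , eq) = u , u∈B , x∈p─q⇒x∉q (N⁺ u) B w∈ ,
    ∈-tabulate⁻ (Arc? u) (p─q⊆p (N⁺ u) B w∈) ,
    λ y uy y∉B → x∈⁅y⁆⇒x≡y w
      (subst (y ∈_) (sym eq) (x∈p∧x∉q⇒x∈p─q (∈-tabulate⁺ (Arc? u) uy) y∉B))
    where
    w∈ : w ∈ N⁺ u ─ B
    w∈ = subst (w ∈_) eq (x∈⁅x⁆ w)

  Forced⁺ : ∀ {B u w} → Forces B u w → Forced D B w
  Forced⁺ {B} {u} {w} (u∈B , w∉B , uw , only) = u , u∈B , ⊆-antisym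
    (λ x∈ → subst (_∈ N⁺ u ─ B) (sym (x∈⁅y⁆⇒x≡y w x∈))
      (x∈p∧x∉q⇒x∈p─q (∈-tabulate⁺ (Arc? u) uw) w∉B))
    (λ {x} x∈ → subst (_∈ ⁅ w ⁆)
      (sym (only x (∈-tabulate⁻ (Arc? u) (p─q⊆p (N⁺ u) B x∈)) (x∈p─q⇒x∉q (N⁺ u) B x∈)))
      (x∈⁅x⁆ w))

  Stalled : Subset n → Set
  Stalled B = ∀ w → ¬ Forced D B w

  stalled-fixed : ∀ {B} → Stalled B → ∀ t → B^ D t B ≡ B
  stalled-fixed stalled zero = refl
  stalled-fixed {B} stalled (suc t) rewrite stalled-fixed stalled t = ⊆-antisym
    (λ {x} x∈ → [ id , (λ x∈F → contradiction (∈-tabulate⁻ (forced? D B) x∈F) (stalled x)) ]′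
      (x∈p∪q⁻ B _ x∈))
    (p⊆p∪q _)

  ⊆-B^ : ∀ S t → S ⊆ B^ D t S
  ⊆-B^ S zero    = id
  ⊆-B^ S (suc t) = p⊆p∪q _ ∘ ⊆-B^ S t

  stalls-or-grows : ∀ S t → (∃ λ s → Stalled (B^ D s S)) ⊎ t ≤ ∣ B^ D t S ∣
  stalls-or-grows S zero    = inj₂ z≤n
  stalls-or-grows S (suc t) with stalls-or-grows S t
  ... | inj₁ stalls = inj₁ stalls
  ... | inj₂ t≤ with any? (forced? D (B^ D t S))
  ...   | no ¬forced = inj₁ (t , λ w forced → ¬forced (w , forced))
  ...   | yes (w , forced) = inj₂ (≤-<-trans t≤ (p⊂q⇒∣p∣<∣q∣
    ( p⊆p∪q _
    , w , q⊆p∪q (B^ D t S) _ (∈-tabulate⁺ (forced? D (B^ D t S)) forced)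
    , proj₁ (proj₂ (proj₂ (Forced⁻ forced))))))

  -- Every round that still forces adds a vertex, so the process from `S` reaches a stalled set,
  -- which is not `⊤` because `S` fails. The upper bound thus reduces to stalled sets.
  stalled-superset : ∀ {S} → IsFZFS D S → ∃ λ B → S ⊆ B × B ≢ ⊤ × Stalled B
  -- Growth through `suc n` rounds would give more than `n` vertices.
  stalled-superset {S} failed with stalls-or-grows S (suc n)
  ... | inj₁ (t , stalled) = B^ D t S , ⊆-B^ S t , (λ eq → failed (t , eq)) , stalled
  ... | inj₂ n< = contradiction (∣p∣≤n (B^ D (suc n) S)) (<⇒≱ n<)

-- Coordinates along the cycle.

module Cycle {n : ℕ} .{{_ : NonZero n}} (D : Digraph n) (v : Permutation′ n)
             (cycle : IsWeakCycle D v) where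
  open Digraph D
  open IsWeakCycle cycle

  -- Places are natural numbers read modulo `n`, so a stretch crossing the origin is still an
  -- interval.
  vertex : ℕ → Fin n
  vertex m = v ⟨$⟩ʳ (m mod n)

  -- The number of forward steps from place `p` to `x`.
  position : Fin n → ℕ → ℕ
  position x p = d (p mod n) (v ⟨$⟩ˡ x)

  vertex-position : ∀ x p → vertex (position x p + p) ≡ x
  vertex-position x p = trans (cong (v ⟨$⟩ʳ_) (trans (mod-cong eq) (mod-d (p mod n) (v ⟨$⟩ˡ x)))) (inverseʳ v)
    where
    eq : (position x p + p) % n ≡ (position x p + toℕ (p mod n)) % n
    eq = trans (sym (%-+ʳ (position x p) p)) (cong (λ r → (position x p + r) % n) (sym (toℕ-mod p)))

  position-vertex : ∀ k p → k < n → position (vertex (k + p)) p ≡ k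
  position-vertex k p k<n = trans (cong (d (p mod n)) (inverseˡ v)) (d-mod p k k<n)

  vertex-periodic : ∀ m → vertex (n + m) ≡ vertex m
  vertex-periodic m = cong (v ⟨$⟩ʳ_)
    (mod-cong (trans (cong (_% n) (+-comm n m)) ([m+n]%n≡m%n m n)))

  vertex-injective : ∀ j k p → j < n → k < n → vertex (j + p) ≡ vertex (k + p) → j ≡ k
  vertex-injective j k p j<n k<n eq = trans (sym (position-vertex j p j<n))
    (trans (cong (λ x → position x p) eq) (position-vertex k p k<n))

  Fwd Bwd : ℕ → Set
  Fwd k = Arc (vertex k) (vertex (suc k))
  Bwd k = Arc (vertex (suc k)) (vertex k)

  fwd-or-bwd : ∀ k → Fwd k ⊎ Bwd k
  fwd-or-bwd k = Equivalence.from (adjacent (k mod n) (suc k mod n)) (inj₁ (sym (next-mod k)))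

  V₋⁺ : ∀ k → Bwd k → ¬ Fwd k → V₋ D v (k mod n)
  V₋⁺ k b ¬f rewrite next-mod {n} k = b , ¬f

  V₊⁺ : ∀ k → Fwd k → ¬ Bwd k → V₊ D v (k mod n)
  V₊⁺ k f ¬b rewrite next-mod {n} k = f , ¬b

  V₋⁻ : ∀ k → V₋ D v (k mod n) → ¬ Fwd k
  V₋⁻ k h rewrite next-mod {n} k = proj₂ h

  V₊⁻ : ∀ k → V₊ D v (k mod n) → ¬ Bwd k
  V₊⁻ k h rewrite next-mod {n} k = proj₂ h

  ¬V₋⇒Fwd : ∀ k → ¬ V₋ D v (k mod n) → Fwd k
  ¬V₋⇒Fwd k ¬V₋ with Arc? (vertex k) (vertex (suc k))
  ... | yes f = f
  ... | no ¬f = [ id , (λ b → contradiction (V₋⁺ k b ¬f) ¬V₋) ]′ (fwd-or-bwd k)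

  ¬V₊⇒Bwd : ∀ k → ¬ V₊ D v (k mod n) → Bwd k
  ¬V₊⇒Bwd k ¬V₊ with Arc? (vertex (suc k)) (vertex k)
  ... | yes b = b
  ... | no ¬b = [ (λ f → contradiction (V₊⁺ k f ¬b) ¬V₊) , id ]′ (fwd-or-bwd k)

  neighbours : ∀ k y → Adjacent (vertex (suc k)) y → y ≡ vertex k ⊎ y ≡ vertex (2 + k)
  neighbours k y adj with Equivalence.to (adjacent (suc k mod n) (v ⟨$⟩ˡ y))
                            (subst (Adjacent (vertex (suc k))) (sym (inverseʳ v)) adj)
  ... | inj₁ y≡ = inj₂ (trans (sym (inverseʳ v)) (cong (v ⟨$⟩ʳ_) (trans y≡ (next-mod (suc k)))))
  -- Here `y` is the predecessor; cancelling the successor modulo `n` identifies its place with `k`.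
  ... | inj₂ ≡next = inj₁ (trans (sym (inverseʳ v)) (cong (v ⟨$⟩ʳ_) (trans (sym (mod-toℕ y′))
        (mod-cong (%-suc-injective (toℕ y′) k
          (trans (sym (toℕ-mod (suc (toℕ y′)))) (trans (cong toℕ (sym ≡next)) (toℕ-mod (suc k)))))))))
    where
    y′ = v ⟨$⟩ˡ y

  window : Subset n → ℕ → ℕ → Bool
  window p a k = lookup p (vertex (k + a))

  -- Permutation invariance of sums puts the vertices in cyclic order, and periodicity lets the
  -- count start at any place.
  ∣p∣≡count-window : ∀ p a → ∣ p ∣ ≡ count (window p a) n
  ∣p∣≡count-window p a = begin
    ∣ p ∣                                        ≡⟨ ∣p∣≡sum p ⟩
    sum (bit ∘ lookup p)                         ≡⟨ sum-permute (bit ∘ lookup p) v ⟩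
    sum (λ i → bit (lookup p (v ⟨$⟩ʳ i)))        ≡⟨ sum-cong-≗ (λ i → cong (λ j → bit (lookup p (v ⟨$⟩ʳ j))) (sym (mod-toℕ i))) ⟩
    sum {n} (λ i → bit (lookup p (vertex (toℕ i)))) ≡⟨ sum≡count n (lookup p ∘ vertex) ⟩
    count (lookup p ∘ vertex) n                  ≡⟨ count-periodic (lookup p ∘ vertex) n (λ m → cong (lookup p) (vertex-periodic m)) a ⟨
    count (window p a) n                         ∎
    where open ≡-Reasoning

  -- With a forward arc, vertex `1 + m`, whose other neighbour is in `B`, would force vertex
  -- `2 + m`.
  rise⇒V₋ : ∀ {B} → Stalled D B → ∀ m →
            lookup (∁ B) (vertex m) ≡ false →
            lookup (∁ B) (vertex (1 + m)) ≡ false →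
            lookup (∁ B) (vertex (2 + m)) ≡ true → V₋ D v (suc m mod n)
  rise⇒V₋ {B} stalled m out₀ out₁ in₂ = V₋⁺ (suc m) ([ (λ f → contradiction f ¬fwd) , id ]′ (fwd-or-bwd (suc m))) ¬fwd
    where
    ¬fwd : ¬ Fwd (suc m)
    ¬fwd f = stalled _ (Forced⁺ D (x∉∁p⇒x∈p (lookup-∉ out₁) , x∈∁p⇒x∉p (lookup-∈ in₂) , f , only))
      where
      only : ∀ y → Arc (vertex (suc m)) y → y ∉ B → y ≡ vertex (2 + m)
      only y uy y∉B with neighbours m y (inj₁ uy)
      ... | inj₁ refl = contradiction (x∉∁p⇒x∈p (lookup-∉ out₀)) y∉B
      ... | inj₂ eq   = eq

  -- Mirror image: with a backward arc, vertex `1 + m` would force vertex `m`.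
  drop⇒V₊ : ∀ {B} → Stalled D B → ∀ m →
            lookup (∁ B) (vertex m) ≡ true →
            lookup (∁ B) (vertex (1 + m)) ≡ false →
            lookup (∁ B) (vertex (2 + m)) ≡ false → V₊ D v (m mod n)
  drop⇒V₊ {B} stalled m in₀ out₁ out₂ = V₊⁺ m ([ id , (λ b → contradiction b ¬bwd) ]′ (fwd-or-bwd m)) ¬bwd
    where
    ¬bwd : ¬ Bwd m
    ¬bwd b = stalled _ (Forced⁺ D (x∉∁p⇒x∈p (lookup-∉ out₁) , x∈∁p⇒x∉p (lookup-∈ in₀) , b , only))
      where
      only : ∀ y → Arc (vertex (suc m)) y → y ∉ B → y ≡ vertex m
      only y uy y∉B with neighbours m y (inj₁ uy)
      ... | inj₁ eq   = eq
      ... | inj₂ refl = contradiction (x∉∁p⇒x∈p (lookup-∉ out₂)) y∉B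

  -- The upper bound.

  module _ {ℓ : ℕ} (isℓ : Isℓ D v ℓ) where

    ℓ<n : ℓ < n
    ℓ<n with proj₁ isℓ
    ... | i , j , _ , _ , eq = subst (_< n) eq (d<n i j)

    gap-bound : ∀ {B} → Stalled D B → ∀ a m → suc m < n →
                window (∁ B) a 0 ≡ false → window (∁ B) a 1 ≡ false → window (∁ B) a (suc m) ≡ true →
                suc ℓ ≤ 2 * ∣ ∁ B ∣
    gap-bound {B} stalled a m m<n out₀ out₁ in₂ with first-rise (window (∁ B) a) m out₀ out₁ in₂
    ... | k , k<m , gap₀ , gap₁ , rise
      -- The second scan starts at the true entry just found. After `n ∸ (2 + k)` further steps it
      -- is back at the gap at `a`, so a drop must occur.
      with first-drop (window (∁ B) (2 + (k + a))) (n ∸ (2 + k)) rise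
             (trans (cong (lookup (∁ B)) wrap₀) out₀) (trans (cong (lookup (∁ B)) wrap₁) out₁)
      where
      around : n ∸ (2 + k) + (2 + (k + a)) ≡ n + a
      around = trans (sym (+-assoc (n ∸ (2 + k)) (2 + k) a))
        (cong (_+ a) (m∸n+n≡m (<⇒≤ (≤-<-trans (s≤s k<m) m<n))))
      wrap₀ : vertex (n ∸ (2 + k) + (2 + (k + a))) ≡ vertex a
      wrap₀ = trans (cong vertex around) (vertex-periodic a)
      wrap₁ : vertex (suc (n ∸ (2 + k) + (2 + (k + a)))) ≡ vertex (suc a)
      wrap₁ = trans (cong vertex (trans (cong suc around) (sym (+-suc n a)))) (vertex-periodic (suc a))
    ...   | k′ , k′< , drop , gap₂ , gap₃ , half = begin
      suc ℓ                  ≤⟨ s≤s (proj₂ isℓ _ (_ , _ , in₋ , in₊ , distance)) ⟩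
      2 + k′                 ≤⟨ half ⟩
      -- The stretch ends before the scan completes a turn, so no vertex is counted twice.
      2 * count W (suc k′)   ≤⟨ *-monoʳ-≤ 2 (count-mono W (≤-trans k′< (m∸n≤m n (2 + k)))) ⟩
      2 * count W n          ≡⟨ cong (2 *_) (∣p∣≡count-window (∁ B) (2 + p)) ⟨
      2 * ∣ ∁ B ∣            ∎
      where
      open ≤-Reasoning
      p = k + a
      W = window (∁ B) (2 + p)
      in₋ : V₋ D v (suc p mod n)
      in₋ = rise⇒V₋ stalled p gap₀ gap₁ rise
      in₊ : V₊ D v ((k′ + (2 + p)) mod n)
      in₊ = drop⇒V₊ stalled (k′ + (2 + p)) drop gap₂ gap₃
      -- The edge in `V₋` starts one place before the stretch, hence `suc k′` rather than `k′`.
      distance : d (suc p mod n) ((k′ + (2 + p)) mod n) ≡ suc k′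
      distance = trans (cong (λ q → d (suc p mod n) (q mod n)) (+-suc k′ (suc p)))
        (d-mod (suc p) (suc k′) (≤-<-trans k′<
          (∸-monoʳ-< {n} {2 + k} {0} (s≤s z≤n) (<⇒≤ (≤-<-trans (s≤s k<m) m<n)))))

    stalled-bound : ∀ {B} → Stalled D B → B ≢ ⊤ → suc ℓ ≤ 2 * ∣ ∁ B ∣
    stalled-bound {B} stalled B≢⊤ with missing B B≢⊤
    ... | w , w∉B with any? (λ (a : Fin n) → (lookup (∁ B) (vertex (toℕ a)) ≟ false)
                                    ×-dec (lookup (∁ B) (vertex (suc (toℕ a))) ≟ false))
    ...   | no ¬gap = ≤-trans ℓ<n (subst (λ c → n ≤ 2 * c) (sym (∣p∣≡count-window (∁ B) p))
                        (count-dense (window (∁ B) p) Wp dense n))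
      where
      -- The window starts at the missing vertex `w`; the `+ 0` is the base place in
      -- `vertex-position w 0`.
      p = position w 0 + 0
      Wp : window (∁ B) p 0 ≡ true
      Wp = trans (cong (lookup (∁ B)) (vertex-position w 0)) ([]=⇒lookup (x∉p⇒x∈∁p w∉B))
      vertex-mod : ∀ k → vertex (toℕ (k mod n)) ≡ vertex k
      vertex-mod k = cong (v ⟨$⟩ʳ_) (mod-toℕ (k mod n))
      vertex-suc-mod : ∀ k → vertex (suc (toℕ (k mod n))) ≡ vertex (suc k)
      vertex-suc-mod k = cong (v ⟨$⟩ʳ_) (next-mod k)
      dense : ∀ k → window (∁ B) p k ≡ false → window (∁ B) p (suc k) ≡ true
      dense k out = ¬-not (λ out′ → ¬gap ((k + p) mod n ,
        trans (cong (lookup (∁ B)) (vertex-mod (k + p))) out ,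
        trans (cong (lookup (∁ B)) (vertex-suc-mod (k + p))) out′))
    ...   | yes (i , out₀ , out₁)
      with position w (toℕ i) | d<n (toℕ i mod n) (v ⟨$⟩ˡ w) | vertex-position w (toℕ i)
    -- Position zero would make `w` a vertex of the gap, hence a member of `B`.
    ...     | zero  | _   | refl = contradiction (x∉∁p⇒x∈p (lookup-∉ out₀)) w∉B
    ...     | suc m | m<n | refl =
      gap-bound stalled (toℕ i) m m<n out₀ out₁ ([]=⇒lookup (x∉p⇒x∈∁p w∉B))

    failed-bound : ∀ {S} → IsFZFS D S → ∣ S ∣ ≤ n ∸ 1 ∸ ⌊ ℓ /2⌋
    failed-bound {S} failed with stalled-superset D failed
    ... | B , S⊆B , B≢⊤ , stalled = begin
      ∣ S ∣                ≤⟨ p⊆q⇒∣p∣≤∣q∣ S⊆B ⟩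
      ∣ B ∣                ≡⟨ m∸[m∸n]≡n (∣p∣≤n B) ⟨
      n ∸ (n ∸ ∣ B ∣)      ≡⟨ cong (n ∸_) (∣∁p∣≡n∸∣p∣ B) ⟨
      n ∸ c                ≤⟨ ∸-monoʳ-≤ n half ⟩
      n ∸ suc ⌊ ℓ /2⌋      ≡⟨ ∸-+-assoc n 1 ⌊ ℓ /2⌋ ⟨
      n ∸ 1 ∸ ⌊ ℓ /2⌋      ∎
      where
      open ≤-Reasoning
      c = ∣ ∁ B ∣
      half : suc ⌊ ℓ /2⌋ ≤ c
      half = begin
        -- One is added to both sides of `suc ℓ ≤ 2 * c` before halving: the left becomes
        -- `suc ⌊ ℓ /2⌋`, the right a rounded-up half of `c + c`.
        ⌊ 2 + ℓ /2⌋          ≤⟨ ⌊n/2⌋-mono (s≤s (stalled-bound stalled B≢⊤)) ⟩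
        ⌈ c + (c + 0) /2⌉    ≡⟨ cong (λ z → ⌈ c + z /2⌉) (+-identityʳ c) ⟩
        ⌈ c + c /2⌉          ≡⟨ n≡⌈n+n/2⌉ c ⟨
        c                    ∎

  -- The extremal failed set.

  module Extremal {ℓ′ : ℕ} (a : Fin n) (isℓ : Isℓ D v (suc ℓ′))
                  (a∈V₋ : V₋ D v a) (end∈V₊ : V₊ D v ((suc ℓ′ + toℕ a) mod n)) where

    ℓ = suc ℓ′
    i = toℕ a

    i∈V₋ : V₋ D v (i mod n)
    i∈V₋ = subst (V₋ D v) (sym (mod-toℕ a)) a∈V₋

    -- By minimality: an edge of `V₋` here would be closer than `ℓ` to the end edge in `V₊`.
    inner-Fwd : ∀ k → suc k ≤ ℓ → Fwd (suc k + i)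
    inner-Fwd k k<ℓ = ¬V₋⇒Fwd (suc k + i) λ e∈V₋ →
      <⇒≱ (∸-monoʳ-< {ℓ} {suc k} {0} (s≤s z≤n) k<ℓ) (proj₂ isℓ _ (_ , _ , e∈V₋ , end∈V₊ , distance))
      where
      distance : d ((suc k + i) mod n) ((ℓ + i) mod n) ≡ ℓ ∸ suc k
      distance = trans
        (cong (λ q → d ((suc k + i) mod n) (q mod n))
          (trans (cong (_+ i) (sym (m∸n+n≡m k<ℓ))) (+-assoc (ℓ ∸ suc k) (suc k) i)))
        (d-mod (suc k + i) (ℓ ∸ suc k) (≤-<-trans (m∸n≤m ℓ (suc k)) (ℓ<n isℓ)))

    -- By minimality: an edge of `V₊` before the end would be closer than `ℓ` to the edge at `i`.
    inner-Bwd : ∀ k → suc k < ℓ → Bwd (suc k + i)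
    inner-Bwd k k<ℓ = ¬V₊⇒Bwd (suc k + i) λ e∈V₊ →
      <⇒≱ k<ℓ (proj₂ isℓ _ (_ , _ , i∈V₋ , e∈V₊ , d-mod i (suc k) (<-trans k<ℓ (ℓ<n isℓ))))

    -- Entry 0 of the pattern sits at vertex `1 + i` and the last at vertex `ℓ + i`. The one-way
    -- edges at both ends of this stretch point out of it.
    T : Subset n
    T = tabulate (pattern-bit ℓ ∘ λ x → position x (suc i))

    lookup-T : ∀ k → k < n → lookup T (vertex (suc k + i)) ≡ pattern-bit ℓ k
    lookup-T k k<n = trans (lookup∘tabulate (pattern-bit ℓ ∘ λ x → position x (suc i)) (vertex (suc k + i)))
      (cong (pattern-bit ℓ) (trans (cong (λ q → position (vertex q) (suc i)) (sym (+-suc k i)))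
        (position-vertex k (suc i) k<n)))

    -- The two neighbours of a vertex are distinct because `3 ≤ n`.
    two-apart : ∀ k → vertex (2 + k) ≢ vertex k
    two-apart k eq with vertex-injective 2 0 k 3≤n (≤-trans (s≤s z≤n) 3≤n) eq
    ... | ()

    ∈T⇒∉∁T : ∀ k → k < ℓ → pattern-bit ℓ k ≡ true → vertex (suc k + i) ∉ ∁ T
    ∈T⇒∉∁T k k<ℓ bit = x∈p⇒x∉∁p (lookup-∈ (trans (lookup-T k (<-trans k<ℓ (ℓ<n isℓ))) bit))

    ∈∁T⇒out : ∀ k → k < n → vertex (suc k + i) ∈ ∁ T → pattern-bit ℓ k ≡ false
    ∈∁T⇒out k k<n x∈ = trans (sym (lookup-T k k<n)) (∉-lookup (x∈∁p⇒x∉p x∈))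

    -- A forcer is a neighbour. From outside the stretch the arc inwards is missing. Inside, a
    -- vertex of `∁ T` lies between two vertices of `T` and has arcs to both, so it forces neither.
    ¬Forces : ∀ {u} k → k < ℓ → ¬ Forces D (∁ T) u (vertex (suc k + i))
    ¬Forces {u} k k<ℓ (u∈ , w∉ , uw , only) with neighbours (k + i) u (inj₂ uw)
    ¬Forces {u} zero    k<ℓ (u∈ , w∉ , uw , only) | inj₁ refl = V₋⁻ i i∈V₋ uw
    ¬Forces {u} (suc zero) k<ℓ (u∈ , w∉ , uw , only) | inj₁ refl =
      contradiction (trans (sym (pattern-first ℓ (s≤s z≤n))) (∈∁T⇒out 0 (<-trans (<-trans (s≤s z≤n) k<ℓ) (ℓ<n isℓ)) u∈)) λ ()
    ¬Forces {u} (suc (suc k)) k<ℓ (u∈ , w∉ , uw , only) | inj₁ refl with true-or-false (pattern-bit ℓ k)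
    -- The predecessor `u` also has an arc back to entry `k`, a second vertex outside `∁ T`.
    ... | inj₁ bit = two-apart (suc k + i)
      (sym (only _ (inner-Bwd k 1+k<ℓ) (∈T⇒∉∁T k (<-trans (n<1+n k) 1+k<ℓ) bit)))
      where
      1+k<ℓ = <-trans (n<1+n (suc k)) k<ℓ
    ... | inj₂ out = contradiction
      (trans (sym (pattern-dense ℓ k 1+k<ℓ out)) (∈∁T⇒out (suc k) (<-trans 1+k<ℓ (ℓ<n isℓ)) u∈)) λ ()
      where
      1+k<ℓ = <-trans (n<1+n (suc k)) k<ℓ
    ¬Forces {u} k k<ℓ (u∈ , w∉ , uw , only) | inj₂ refl with m≤n⇒m<n∨m≡n k<ℓ
    ... | inj₂ refl = V₊⁻ (suc k + i) end∈V₊ uw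
    ... | inj₁ 1+k<ℓ with ∈∁T⇒out (suc k) (<-trans 1+k<ℓ (ℓ<n isℓ)) u∈ | m≤n⇒m<n∨m≡n 1+k<ℓ
    -- Here `u` carries the last entry, which is true, so it cannot lie in `∁ T`.
    ...   | out | inj₂ refl = contradiction (trans (sym (pattern-last (suc k))) out) λ ()
    ...   | out | inj₁ 2+k<ℓ = two-apart (suc k + i)
      (only _ (inner-Fwd (suc k) 1+k<ℓ) (∈T⇒∉∁T (2 + k) 2+k<ℓ (pattern-dense ℓ (suc k) 2+k<ℓ out)))

    ∁T-stalled : Stalled D (∁ T)
    ∁T-stalled w forced with Forced⁻ D forced
    ... | u , forces@(_ , w∉ , _) = ¬Forces k k<ℓ (subst (Forces D (∁ T) u) (sym w≡) forces)
      where
      k = position w (suc i)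
      w≡ : vertex (suc k + i) ≡ w
      w≡ = trans (cong vertex (sym (+-suc k i))) (vertex-position w (suc i))
      k<ℓ : k < ℓ
      k<ℓ = pattern-support ℓ k (trans (sym (lookup∘tabulate _ w)) ([]=⇒lookup (x∉∁p⇒x∈p w∉)))

    ∁T-failed : IsFZFS D (∁ T)
    ∁T-failed (t , eq) = ∈T⇒∉∁T 0 (s≤s z≤n) (pattern-first ℓ (s≤s z≤n))
      (subst (vertex (suc i) ∈_) (trans (sym eq) (stalled-fixed D ∁T-stalled t)) ∈⊤)

    ∣∁T∣ : ∣ ∁ T ∣ ≡ n ∸ 1 ∸ ⌊ ℓ /2⌋
    ∣∁T∣ = begin
      ∣ ∁ T ∣                          ≡⟨ ∣∁p∣≡n∸∣p∣ T ⟩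
      n ∸ ∣ T ∣                        ≡⟨ cong (n ∸_) (∣p∣≡count-window T (suc i)) ⟩
      n ∸ count (window T (suc i)) n   ≡⟨ cong (n ∸_) (count-cong n (λ k k<n →
                                            trans (cong (lookup T ∘ vertex) (+-suc k i)) (lookup-T k k<n))) ⟩
      n ∸ count (pattern-bit ℓ) n      ≡⟨ cong (n ∸_) (count-pattern ℓ′ n (<⇒≤ (ℓ<n isℓ))) ⟩
      n ∸ suc ⌊ ℓ /2⌋                  ≡⟨ ∸-+-assoc n 1 ⌊ ℓ /2⌋ ⟨
      n ∸ 1 ∸ ⌊ ℓ /2⌋                  ∎
      where open ≡-Reasoning

  failed-exists : ∀ {ℓ} → Isℓ D v ℓ → ∃ λ S → IsFZFS D S × ∣ S ∣ ≡ n ∸ 1 ∸ ⌊ ℓ /2⌋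
  -- Distance zero would put one edge in both `V₋` and `V₊`.
  failed-exists {zero} ((i , j , i∈V₋ , j∈V₊ , eq) , _) =
    contradiction (proj₁ (subst (V₊ D v) j≡i j∈V₊)) (proj₂ i∈V₋)
    where
    j≡i : j ≡ i
    j≡i = trans (sym (mod-d i j)) (trans (cong (λ k → (k + toℕ i) mod n) eq) (mod-toℕ i))
  failed-exists {suc ℓ′} isℓ@((i , j , i∈V₋ , j∈V₊ , eq) , _) = ∁ T , ∁T-failed , ∣∁T∣
    where
    open Extremal i isℓ i∈V₋
      (subst (V₊ D v) (trans (sym (mod-d i j)) (cong (λ k → (k + toℕ i) mod n) eq)) j∈V₊)

theorem4p10 : ∀ {n : ℕ} .{{_ : NonZero n}} (D : Digraph n) (v : Permutation′ n) →
    IsWeakCycle D v →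
    Satisfiable (V₀ D v) → Satisfiable (V₋ D v) → Satisfiable (V₊ D v) →
    ∀ (ℓ : ℕ) → Isℓ D v ℓ →
    IsF D (n ∸ 1 ∸ ⌊ ℓ /2⌋)
theorem4p10 D v cycle _ _ _ ℓ isℓ =
  failed-exists isℓ , λ k (S , failed , ∣S∣≡k) → subst (_≤ _) ∣S∣≡k (failed-bound isℓ failed)
  where
  open Cycle D v cycle
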